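{- Let $\alpha\in\mathbb{N}=\{0,1,2,\dots\}$ and let $m$ be a positive odd integer with $m>4\alpha+2$. Let $\mathbb{S}=\langle 4,4\alpha+2,m\rangle$. Then the set of Betti elements of $\mathbb{S}$ is $Betti(\mathbb{S})=\{8\alpha+4,\,2m\}$.
   Context: $\mathbb{N}$ denotes the set of nonnegative integers. For positive integers $a_1,\dots,a_e$ with $\gcd=1$, $\langle a_1,\dots,a_e\rangle=\{\lambda_1a_1+\dots+\lambda_ea_e:\lambda_i\in\mathbb{N}\}$ is a numerical semigroup. For $a\in\mathbb{S}$, the set of factorizations of $a$ with respect to the listed generators is $Z(a)=\{(\eta_1,\dots,\eta_e)\in\mathbb{N}^e:\eta_1a_1+\dots+\eta_ea_e=a\}$. For $x,y\in\mathbb{N}^e$, $\gcd\{x,y\}$ is the componentwise minimum. For $a\in\mathbb{S}\setminus\{0\}$, let $\nabla_a$ be the graph with vertex set $Z(a)$ in which $x,y$ are joined by an edge if $\gcd\{x,y\}\neq 0$. The element $a$ is a Betti element of $\mathbb{S}$ if $\nabla_a$ is disconnected; $Betti(\mathbb{S})$ denotes the set of Betti elements. -}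

module Defs where

open import Data.Nat using (ℕ; _*_; _⊓_)
open import Data.Product using (∃; Σ; _×_; proj₁)
open import Data.Vec using (Vec; zipWith; sum; replicate)
open import Level using (0ℓ)
open import Relation.Binary.Core using (Rel)
open import Relation.Binary.Construct.Closure.ReflexiveTransitive using (Star)
open import Relation.Binary.PropositionalEquality using (_≡_; _≢_)
open import Relation.Nullary using (¬_)
open import Relation.Unary using (Pred; _∈_)

infix 7 _·_

_·_ : ∀ {e} → Vec ℕ e → Vec ℕ e → ℕ
η · as = sum (zipWith _*_ η as)

⟨_⟩ : ∀ {e} → Vec ℕ e → Pred ℕ 0ℓ
⟨ as ⟩ a = ∃ λ η → η · as ≡ a

Z : ∀ {e} → Vec ℕ e → ℕ → Set
Z {e} as a = Σ (Vec ℕ e) λ η → η · as ≡ a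

gcdᵛ : ∀ {e} → Vec ℕ e → Vec ℕ e → Vec ℕ e
gcdᵛ = zipWith _⊓_

-- The graph ∇ₐ is given by its adjacency relation on the vertex type Z as a.
-- The relation is symmetric, and the loops it has are harmless for connectedness.
∇ : ∀ {e} (as : Vec ℕ e) (a : ℕ) → Rel (Z as a) 0ℓ
∇ {e} as a x y = gcdᵛ (proj₁ x) (proj₁ y) ≢ replicate e 0

-- Star suffices for undirected paths when the adjacency relation is symmetric.
Connected : {V : Set} → Rel V 0ℓ → Set
Connected E = ∀ x y → Star E x y

Betti : ∀ {e} → Vec ℕ e → Pred ℕ 0ℓ
Betti as a = a ∈ ⟨ as ⟩ × a ≢ 0 × ¬ Connected (∇ as a)

{-# OPTIONS --safe #-}

-- Write m = 2 j + 1 with j = 2 α + 1 + t.  The relations 2 (4α+2) = (2α+1) 4 and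
-- 2 m = (α+1+t) 4 + (4α+2) rewrite every factorization to one whose last two
-- coordinates are at most 1, and that one is unique.  A rewriting step is an edge of ∇ₐ
-- unless it uses up the whole factorization, which happens only for a = 2 (4α+2) or a = 2 m.
-- Conversely, 4α+2 and m have a unique factorization each, so the factorization of twice
-- such a generator as the generator plus itself has no neighbour other than itself.
module Submission where

open import Defs
open import Data.Nat using (ℕ; zero; suc; _+_; _*_; _<_; _>_; _≤_; z≤n; s≤s; s≤s⁻¹; _≟_)
open import Data.Nat.Divisibility using (_∣_; m∣m*n)
open import Data.Nat.Properties
open import Data.Nat.Tactic.RingSolver using (solve-∀)
open import Data.Product using (∃; _×_; _,_; proj₁; proj₂)
open import Data.Sum using (_⊎_; inj₁; inj₂)
open import Data.Vec using (Vec; _∷_; []; replicate)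
open import Data.Vec.Properties using (zipWith-comm)
open import Data.Vec.Relation.Unary.All as All using (All)
open import Function using (id; _∘_)
open import Relation.Binary.Construct.Closure.ReflexiveTransitive
  using (Star; ε; _◅_; _◅◅_; fold; reverse)
open import Relation.Binary.Core using (Rel)
open import Relation.Binary.Definitions using (Symmetric)
open import Relation.Binary.PropositionalEquality
open import Relation.Nullary using (¬_; yes; no; contradiction)
open import Relation.Unary using (_≐_; _∪_; ｛_｝; _∈_)

open ≡-Reasoning

even⊎odd : ∀ n → ∃ λ q → n ≡ 2 * q ⊎ n ≡ suc (2 * q)
even⊎odd zero = 0 , inj₁ refl
even⊎odd (suc n) with even⊎odd n
... | q , inj₁ n≡2q   = q , inj₂ (cong suc n≡2q)
... | q , inj₂ n≡1+2q = suc q , inj₁ (trans (cong suc n≡1+2q) (sym (*-suc 2 q)))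

-- Uniqueness of division by 2. It is applied twice in `reduced-unique`, to read off `z` and then
-- `y`.
r+2q-injective : ∀ {r s} p q → r < 2 → s < 2 → r + 2 * p ≡ s + 2 * q → r ≡ s × p ≡ q
r+2q-injective {0} {0} p q _ _ eq = refl , *-cancelˡ-≡ p q 2 eq
r+2q-injective {0} {1} p q _ _ eq = contradiction eq (even≢odd p q)
r+2q-injective {1} {0} p q _ _ eq = contradiction (sym eq) (even≢odd q p)
r+2q-injective {1} {1} p q _ _ eq = refl , *-cancelˡ-≡ p q 2 (suc-injective eq)
r+2q-injective {suc (suc _)} _ _ (s≤s (s≤s ())) _ _
r+2q-injective {0} {suc (suc _)} _ _ _ (s≤s (s≤s ())) _
r+2q-injective {1} {suc (suc _)} _ _ _ (s≤s (s≤s ())) _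

·-zero : ∀ {e} {as : Vec ℕ e} (η : Vec ℕ e) → All (_≢ 0) as → η · as ≡ 0 → η ≡ replicate e 0
·-zero [] All.[] _ = refl
·-zero {as = a ∷ _} (x ∷ η) (a≢0 All.∷ as≢0) eq with m*n≡0⇒m≡0∨n≡0 x (m+n≡0⇒m≡0 (x * a) eq)
... | inj₁ x≡0 = cong₂ _∷_ x≡0 (·-zero η as≢0 (m+n≡0⇒n≡0 (x * a) eq))
... | inj₂ a≡0 = contradiction a≡0 a≢0

m+n≡m⇒n≡0 : ∀ m {n} → m + n ≡ m → n ≡ 0
m+n≡m⇒n≡0 m eq = +-cancelˡ-≡ m _ 0 (trans eq (sym (+-identityʳ m)))

∇-sym : ∀ {e} (as : Vec ℕ e) a → Symmetric (∇ as a)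
∇-sym as a {x} {y} xy eq = xy (trans (zipWith-comm ⊓-comm (proj₁ x) (proj₁ y)) eq)

Z-≡ : ∀ {e} {as : Vec ℕ e} {a} {x y : Z as a} → proj₁ x ≡ proj₁ y → x ≡ y
Z-≡ {x = _ , p} {_ , q} refl = cong (_ ,_) (≡-irrelevant p q)

-- Folding over a path carries `P` from its start to its end, so no path leads from `v` to `w`.
closed⇒disconnected : {V : Set} {E : Rel V _} (P : V → Set) →
  (∀ v w → E v w → P v → P w) → ∀ {v w} → P v → ¬ P w → ¬ Connected E
closed⇒disconnected P closed {v} {w} Pv ¬Pw connected =
  ¬Pw (fold (λ v w → P v → P w) (λ vw f → f ∘ closed _ _ vw) id (connected v w) Pv)

-- Sums x * 4 + (y * (4 * α + 2) + (z * m + 0)) are written as _·_ unfolds them: the ring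
-- solver does not look through definitions.
2b-identity : ∀ α m x y z →
  (x + (2 * α + 1)) * 4 + (y * (4 * α + 2) + (z * m + 0)) ≡
  x * 4 + ((2 + y) * (4 * α + 2) + (z * m + 0))
2b-identity = solve-∀

2m-identity : ∀ α t x y z →
  (x + (α + 1 + t)) * 4 + ((1 + y) * (4 * α + 2) + (z * suc (2 * (2 * α + 1 + t)) + 0)) ≡
  x * 4 + (y * (4 * α + 2) + ((2 + z) * suc (2 * (2 * α + 1 + t)) + 0))
2m-identity = solve-∀

suc₂-identity : ∀ α m x y z →
  x * 4 + (suc y * (4 * α + 2) + (z * m + 0)) ≡
  4 * α + 2 + (x * 4 + (y * (4 * α + 2) + (z * m + 0)))
suc₂-identity = solve-∀

suc₃-identity : ∀ α m x y z →
  x * 4 + (y * (4 * α + 2) + (suc z * m + 0)) ≡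
  m + (x * 4 + (y * (4 * α + 2) + (z * m + 0)))
suc₃-identity = solve-∀

-- The generators 4 and 4α+2 are even and 2j+1 is odd, so `z` has the parity of the sum. In the
-- remaining half, once `z * j` is removed, `y` has the parity of what is left.
binary-identity : ∀ α j x y z →
  x * 4 + (y * (4 * α + 2) + (z * suc (2 * j) + 0)) ≡
  z + 2 * (z * j + (y + 2 * (x + y * α)))
binary-identity = solve-∀

4n+2+2t≡2[2n+1+t] : ∀ n t → 4 * n + 2 + 2 * t ≡ 2 * (2 * n + 1 + t)
4n+2+2t≡2[2n+1+t] = solve-∀

2[4n+2]≡8n+4 : ∀ n → 2 * (4 * n + 2) ≡ 8 * n + 4
2[4n+2]≡8n+4 = solve-∀

[2n+1]4≡8n+4 : ∀ n → (2 * n + 1) * 4 ≡ 8 * n + 4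
[2n+1]4≡8n+4 = solve-∀

n4≡2[2n] : ∀ n → n * 4 ≡ 2 * (2 * n)
n4≡2[2n] = solve-∀

4n+2≡2[1+2n] : ∀ n → 4 * n + 2 ≡ 2 * suc (2 * n)
4n+2≡2[1+2n] = solve-∀

module _ (α t : ℕ) where

  b j m k : ℕ
  b = 4 * α + 2
  j = 2 * α + 1 + t
  m = suc (2 * j)
  k = α + 1 + t

  gens : Vec ℕ 3
  gens = 4 ∷ b ∷ m ∷ []

  gens≢0 : All (_≢ 0) gens
  gens≢0 = (λ ()) All.∷ m+1+n≢0 (4 * α) All.∷ (λ ()) All.∷ All.[]

  value : ℕ → ℕ → ℕ → ℕ
  value x y z = (x ∷ y ∷ z ∷ []) · gens

  b<m : b < m
  b<m = s≤s (≤-trans (m≤m+n b (2 * t)) (≤-reflexive (4n+2+2t≡2[2n+1+t] α t)))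

  2b-relation : ∀ x y z → value (x + (2 * α + 1)) y z ≡ value x (2 + y) z
  2b-relation = 2b-identity α m

  2m-relation : ∀ x y z → value (x + k) (1 + y) z ≡ value x y (2 + z)
  2m-relation = 2m-identity α t

  value-suc₂ : ∀ x y z → value x (suc y) z ≡ b + value x y z
  value-suc₂ = suc₂-identity α m

  value-suc₃ : ∀ x y z → value x y (suc z) ≡ m + value x y z
  value-suc₃ = suc₃-identity α m

  value-binary : ∀ x y z → value x y z ≡ z + 2 * (z * j + (y + 2 * (x + y * α)))
  value-binary = binary-identity α j

  value-2b : value 0 2 0 ≡ 8 * α + 4
  value-2b = trans (+-identityʳ (2 * b)) (2[4n+2]≡8n+4 α)

  value-2m : value 0 0 2 ≡ 2 * m
  value-2m = +-identityʳ (2 * m)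

  Reduced : Vec ℕ 3 → Set
  Reduced (_ ∷ y ∷ z ∷ []) = y < 2 × z < 2

  -- The value fixes `z` by its parity, then `y` by the parity of the next quotient, and finally `x`
  -- by cancellation.
  reduced-unique : ∀ v w → Reduced v → Reduced w → v · gens ≡ w · gens → v ≡ w
  reduced-unique (x ∷ y ∷ z ∷ []) (x′ ∷ y′ ∷ z′ ∷ []) (y<2 , z<2) (y′<2 , z′<2) eq
    with r+2q-injective (z * j + (y + 2 * (x + y * α))) (z′ * j + (y′ + 2 * (x′ + y′ * α)))
           z<2 z′<2 (trans (sym (value-binary x y z)) (trans eq (value-binary x′ y′ z′)))
  ... | refl , eq₁
    with r+2q-injective (x + y * α) (x′ + y′ * α) y<2 y′<2 (+-cancelˡ-≡ (z * j) _ _ eq₁)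
  ... | refl , eq₂ = cong (_∷ y ∷ z ∷ []) (+-cancelʳ-≡ (y * α) x x′ eq₂)

  module _ {a : ℕ} (2b≢a : 8 * α + 4 ≢ a) (2m≢a : 2 * m ≢ a) where

    infix 4 _⟶*_
    _⟶*_ : Rel (Z gens a) _
    _⟶*_ = Star (∇ gens a)

    -- The componentwise minimum is (x, y, z), the part that the rewriting step leaves alone. If it
    -- vanishes, then `p` says that `a` is 2b.
    2b-edge : ∀ x y z p q → ∇ gens a (x ∷ 2 + y ∷ z ∷ [] , p) (x + (2 * α + 1) ∷ y ∷ z ∷ [] , q)
    2b-edge x y z p q gcd≡0
      rewrite m≤n⇒m⊓n≡m (m≤m+n x (2 * α + 1)) | m≥n⇒m⊓n≡n (m≤n+m y 2) | ⊓-idem z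
      with refl ← gcd≡0 = 2b≢a (trans (sym value-2b) p)

    -- The minimum is again (x, y, z), and it vanishes only if `a` is 2m.
    2m-edge : ∀ x y z p q → ∇ gens a (x ∷ y ∷ 2 + z ∷ [] , p) (x + k ∷ 1 + y ∷ z ∷ [] , q)
    2m-edge x y z p q gcd≡0
      rewrite m≤n⇒m⊓n≡m (m≤m+n x k) | m≤n⇒m⊓n≡m (m≤n+m y 1) | m≥n⇒m⊓n≡n (m≤n+m z 2)
      with refl ← gcd≡0 = 2m≢a (trans (sym value-2m) p)

    reduce₂ : ∀ x y z (p : value x y z ≡ a) → z < 2 →
      ∃ λ w → Reduced (proj₁ w) × (x ∷ y ∷ z ∷ [] , p) ⟶* w
    reduce₂ x 0 z p z<2 = _ , (s≤s z≤n , z<2) , ε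
    reduce₂ x 1 z p z<2 = _ , (s≤s (s≤s z≤n) , z<2) , ε
    reduce₂ x (suc (suc y)) z p z<2 =
      let q = trans (2b-relation x y z) p
          w , red , path = reduce₂ (x + (2 * α + 1)) y z q z<2
      in w , red , 2b-edge x y z p q ◅ path

    -- The last coordinate is reduced first: replacing 2m raises `y`, whereas the steps of `reduce₂`
    -- never change `z`.
    reduce₃ : ∀ x y z (p : value x y z ≡ a) →
      ∃ λ w → Reduced (proj₁ w) × (x ∷ y ∷ z ∷ [] , p) ⟶* w
    reduce₃ x y 0 p = reduce₂ x y 0 p (s≤s z≤n)
    reduce₃ x y 1 p = reduce₂ x y 1 p (s≤s (s≤s z≤n))
    reduce₃ x y (suc (suc z)) p =
      let q = trans (2m-relation x y z) p
          w , red , path = reduce₃ (x + k) (suc y) z q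
      in w , red , 2m-edge x y z p q ◅ path

    connected : Connected (∇ gens a)
    connected (x ∷ y ∷ z ∷ [] , p) (x′ ∷ y′ ∷ z′ ∷ [] , p′) =
      let w  , red  , path  = reduce₃ x y z p
          w′ , red′ , path′ = reduce₃ x′ y′ z′ p′
          w≡w′ = Z-≡ (reduced-unique (proj₁ w) (proj₁ w′) red red′
                        (trans (proj₂ w) (sym (proj₂ w′))))
          back = reverse (λ {v} {w} → ∇-sym gens a {v} {w}) path′
      in path ◅◅ subst (_⟶* _) (sym w≡w′) back

  -- The generator `m` is too large to occur. If `b` occurs, nothing else fits. The generator 4
  -- alone fails because b/2 is odd.
  b-unique : ∀ x y z → value x y z ≡ b → x ∷ y ∷ z ∷ [] ≡ 0 ∷ 1 ∷ 0 ∷ []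
  b-unique x y (suc z) eq =
    contradiction (subst (m ≤_) (trans (sym (value-suc₃ x y z)) eq) (m≤m+n m _)) (<⇒≱ b<m)
  b-unique x (suc y) 0 eq
    with refl ← ·-zero (x ∷ y ∷ 0 ∷ []) gens≢0
                  (m+n≡m⇒n≡0 b (trans (sym (value-suc₂ x y 0)) eq)) = refl
  b-unique x 0 0 eq = contradiction
    (*-cancelˡ-≡ (2 * x) (suc (2 * α)) 2 (begin
      2 * (2 * x)      ≡⟨ n4≡2[2n] x ⟨
      x * 4            ≡⟨ +-identityʳ (x * 4) ⟨
      x * 4 + 0        ≡⟨ eq ⟩
      b                ≡⟨ 4n+2≡2[1+2n] α ⟩
      2 * suc (2 * α)  ∎))
    (even≢odd x α)

  -- Without `m` the value is even, and with one `m` the rest has value 0.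
  m-unique : ∀ x y z → value x y z ≡ m → x ∷ y ∷ z ∷ [] ≡ 0 ∷ 0 ∷ 1 ∷ []
  m-unique x y (suc z) eq
    with refl ← ·-zero (x ∷ y ∷ z ∷ []) gens≢0
                  (m+n≡m⇒n≡0 m (trans (sym (value-suc₃ x y z)) eq)) = refl
  m-unique x y 0 eq =
    contradiction (trans (sym (value-binary x y 0)) eq) (even≢odd (y + 2 * (x + y * α)) j)

  2b-disconnected : ¬ Connected (∇ gens (8 * α + 4))
  2b-disconnected = closed⇒disconnected (λ v → proj₁ v ≡ 0 ∷ 2 ∷ 0 ∷ []) closed
    {0 ∷ 2 ∷ 0 ∷ [] , value-2b}
    {2 * α + 1 ∷ 0 ∷ 0 ∷ [] , trans (+-identityʳ _) ([2n+1]4≡8n+4 α)} refl (λ ())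
    where
    closed : ∀ v w → ∇ gens (8 * α + 4) v w →
      proj₁ v ≡ 0 ∷ 2 ∷ 0 ∷ [] → proj₁ w ≡ 0 ∷ 2 ∷ 0 ∷ []
    -- A factorization without `b` has minimum zero with (0, 2, 0), so it is not a neighbour.
    closed _ (x ∷ 0 ∷ z ∷ [] , _) vw refl = contradiction refl vw
    -- Taking one `b` away leaves a factorization of `b`, to which `b-unique` applies.
    closed _ (x ∷ suc y ∷ z ∷ [] , p) _ _
      with refl ← b-unique x y z (+-cancelˡ-≡ b _ _ (begin
             b + value x y z    ≡⟨ value-suc₂ x y z ⟨
             value x (suc y) z  ≡⟨ p ⟩
             8 * α + 4          ≡⟨ 2[4n+2]≡8n+4 α ⟨
             2 * b              ≡⟨ cong (b +_) (+-identityʳ b) ⟩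
             b + b              ∎)) = refl

  2m-disconnected : ¬ Connected (∇ gens (2 * m))
  2m-disconnected = closed⇒disconnected (λ v → proj₁ v ≡ 0 ∷ 0 ∷ 2 ∷ []) closed
    {0 ∷ 0 ∷ 2 ∷ [] , value-2m}
    -- The second vertex is the other side of the relation for 2m.
    {k ∷ 1 ∷ 0 ∷ [] , trans (2m-relation 0 0 0) value-2m} refl (λ ())
    where
    closed : ∀ v w → ∇ gens (2 * m) v w →
      proj₁ v ≡ 0 ∷ 0 ∷ 2 ∷ [] → proj₁ w ≡ 0 ∷ 0 ∷ 2 ∷ []
    closed _ (x ∷ y ∷ 0 ∷ [] , _) vw refl = contradiction refl vw
    closed _ (x ∷ y ∷ suc z ∷ [] , p) _ _
      with refl ← m-unique x y z (+-cancelˡ-≡ m _ _ (begin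
             m + value x y z    ≡⟨ value-suc₃ x y z ⟨
             value x y (suc z)  ≡⟨ p ⟩
             2 * m              ≡⟨ cong (m +_) (+-identityʳ m) ⟩
             m + m              ∎)) = refl

  Betti-gens : Betti gens ≐ ｛ 8 * α + 4 ｝ ∪ ｛ 2 * m ｝
  Betti-gens = to , from
    where
    to : ∀ {a} → a ∈ Betti gens → a ∈ ｛ 8 * α + 4 ｝ ∪ ｛ 2 * m ｝
    to {a} (_ , _ , disconnected) with 8 * α + 4 ≟ a | 2 * m ≟ a
    ... | yes 2b≡a | _        = inj₁ 2b≡a
    ... | no _     | yes 2m≡a = inj₂ 2m≡a
    ... | no 2b≢a  | no 2m≢a  = contradiction (connected 2b≢a 2m≢a) disconnected

    from : ∀ {a} → a ∈ ｛ 8 * α + 4 ｝ ∪ ｛ 2 * m ｝ → a ∈ Betti gens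
    from (inj₁ refl) =
      (0 ∷ 2 ∷ 0 ∷ [] , value-2b) , m+1+n≢0 (8 * α) , 2b-disconnected
    from (inj₂ refl) = (0 ∷ 0 ∷ 2 ∷ [] , value-2m) , (λ ()) , 2m-disconnected

2*[2n+1]≡4n+2 : ∀ n → 2 * (2 * n + 1) ≡ 4 * n + 2
2*[2n+1]≡4n+2 = solve-∀

theorem3 : (α m : ℕ) → 0 < m → ¬ (2 ∣ m) → m > 4 * α + 2 →
    Betti (4 ∷ 4 * α + 2 ∷ m ∷ []) ≐ ｛ 8 * α + 4 ｝ ∪ ｛ 2 * m ｝
theorem3 α m _ 2∤m m>b with even⊎odd m
... | q , inj₁ refl = contradiction (m∣m*n q) 2∤m
... | q , inj₂ refl
  -- From 4α+2 < 2q+1 follows 4α+2 ≤ 2q. Halving gives 2α+1 ≤ q, and `t` is the difference.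
  with t , refl ← m≤n⇒∃[o]m+o≡n {2 * α + 1} {q}
         (*-cancelˡ-≤ 2 (≤-trans (≤-reflexive (2*[2n+1]≡4n+2 α)) (s≤s⁻¹ m>b)))
  = Betti-gens α t
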